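{- The class $\mathcal{ME}$ of modularly extended matroids coincides with the smallest class of simple matroids which contains all supersolvable simple matroids and is closed under taking modular joins over round flats (i.e., if $M=P_X(M_1,M_2)$ is a modular join over a round flat $X$ and $M_1,M_2$ lie in the class, then so does $M$).
   Context: All matroids are finite. For a simple matroid $M$ on ground set $E$ with rank function $r$, flats ordered by inclusion form the lattice $L(M)$, with $X\vee Y=\mathrm{cl}(X\cup Y)$. A coatom is a flat of rank $r(E)-1$. A flat $X$ is modular if $r(X)+r(Y)=r(X\cap Y)+r(X\vee Y)$ for every flat $Y$. $M|X$ denotes restriction. A simple matroid is supersolvable if it has a maximal chain of flats $\varnothing=X_0\subsetneq X_1\subsetneq\dots\subsetneq X_{r(E)}=E$ consisting of modular flats. A simple matroid $M$ is a modular join if $E=E_1\cup E_2$ for two proper modular flats $E_1,E_2$; then one writes $M=P_X(M_1,M_2)$ with $M_i=M|E_i$ and $X=E_1\cap E_2$ (modular join over $X$). A matroid is round if its ground set is not the union of two proper flats; a flat $S$ is round if $M|S$ is round. $\mathcal{ME}$ is the smallest class of simple matroids such that: (i) the empty matroid is in $\mathcal{ME}$; (ii) if a simple matroid $M$ has a modular coatom $X$ with $M|X\in\mathcal{ME}$, then $M\in\mathcal{ME}$; (iii) if $M$ is a modular join $P_X(M_1,M_2)$ over a round flat $X$ with $M_1,M_2\in\mathcal{ME}$, then $M\in\mathcal{ME}$. -}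

module Defs where

open import Data.Nat using (ℕ; zero; suc; _+_; _≤_; _≡ᵇ_)
import Data.Bool
open import Data.Bool using (Bool; _∧_; if_then_else_)
open import Data.Fin using (Fin; fromℕ; inject₁)
import Data.Fin as F
open import Data.Fin.Subset using (Subset; _∈_; _∉_; _⊆_; _⊂_; _∪_; _∩_; ⁅_⁆; ∣_∣; inside; outside)
  renaming (⊥ to ∅)
open import Data.Fin.Subset.Properties using (_∈?_)
open import Data.Vec using (tabulate)
open import Data.Product using (Σ; ∃; _×_; _,_)
open import Relation.Nullary using (¬_; Dec; yes; no)
open import Relation.Binary.PropositionalEquality using (_≡_; _≢_)

-- A (pre)matroid presentation on the finite carrier Fin n:
-- a ground set E ⊆ Fin n and a rank function r (only its values on
-- subsets of E are ever used).  Restriction keeps the carrier and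
-- shrinks the ground set.
record Pre (n : ℕ) : Set where
  constructor pre
  field
    E : Subset n
    r : Subset n → ℕ
open Pre public

record IsMatroid {n : ℕ} (M : Pre n) : Set where
  field
    r-card  : ∀ A → A ⊆ E M → r M A ≤ ∣ A ∣
    r-mono  : ∀ A B → B ⊆ E M → A ⊆ B → r M A ≤ r M B
    r-submod : ∀ A B → A ⊆ E M → B ⊆ E M →
               r M (A ∪ B) + r M (A ∩ B) ≤ r M A + r M B

record IsSimple {n : ℕ} (M : Pre n) : Set where
  field
    matroid  : IsMatroid M
    no-loop  : ∀ e → e ∈ E M → r M ⁅ e ⁆ ≡ 1
    no-para  : ∀ e f → e ∈ E M → f ∈ E M → e ≢ f → r M (⁅ e ⁆ ∪ ⁅ f ⁆) ≡ 2

_∣_ : ∀ {n} → Pre n → Subset n → Pre n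
M ∣ X = pre X (r M)

cl : ∀ {n} → Pre n → Subset n → Subset n
cl M A = tabulate λ e →
  (if isIn e then inside else outside) ∧ (r M (A ∪ ⁅ e ⁆) ≡ᵇ r M A)
  where
  isIn : _ → Bool
  isIn e with e ∈? E M
  ... | yes _ = Data.Bool.true
  ... | no _  = Data.Bool.false

IsFlat : ∀ {n} → Pre n → Subset n → Set
IsFlat M F = F ⊆ E M × (∀ e → e ∈ E M → e ∉ F → r M F ≢ r M (F ∪ ⁅ e ⁆))

_∨[_]_ : ∀ {n} → Subset n → Pre n → Subset n → Subset n
X ∨[ M ] Y = cl M (X ∪ Y)

IsModularFlat : ∀ {n} → Pre n → Subset n → Set
IsModularFlat M X = IsFlat M X ×
  (∀ Y → IsFlat M Y → r M X + r M Y ≡ r M (X ∩ Y) + r M (X ∨[ M ] Y))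

IsCoatom : ∀ {n} → Pre n → Subset n → Set
IsCoatom M X = IsFlat M X × suc (r M X) ≡ r M (E M)

IsSupersolvable : ∀ {n} → Pre n → Set
IsSupersolvable M =
  Σ (Fin (suc (r M (E M))) → Subset _) λ X →
    (X F.zero ≡ ∅) × (X (fromℕ (r M (E M))) ≡ E M) ×
    (∀ i → IsModularFlat M (X i)) ×
    (∀ (i : Fin (r M (E M))) → X (inject₁ i) ⊂ X (F.suc i))

IsRound : ∀ {n} → Pre n → Set
IsRound M = ¬ (Σ _ λ F₁ → Σ _ λ F₂ →
  IsFlat M F₁ × IsFlat M F₂ × F₁ ≢ E M × F₂ ≢ E M × (F₁ ∪ F₂) ≡ E M)

-- M = P_X(M|E₁, M|E₂) is a modular join over a round flat X = E₁ ∩ E₂.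
IsRoundModularJoin : ∀ {n} → Pre n → Subset n → Subset n → Set
IsRoundModularJoin M E₁ E₂ =
  IsModularFlat M E₁ × IsModularFlat M E₂ × E₁ ≢ E M × E₂ ≢ E M ×
  (E₁ ∪ E₂) ≡ E M × IsRound (M ∣ (E₁ ∩ E₂))

data ME {n : ℕ} : Pre n → Set where
  me-empty : ∀ M → IsSimple M → E M ≡ ∅ → ME M
  me-coatom : ∀ M X → IsSimple M → IsCoatom M X → IsModularFlat M X →
              ME (M ∣ X) → ME M
  me-join : ∀ M E₁ E₂ → IsSimple M → IsRoundModularJoin M E₁ E₂ →
            ME (M ∣ E₁) → ME (M ∣ E₂) → ME M

data SSJ {n : ℕ} : Pre n → Set where
  ssj-ss   : ∀ M → IsSimple M → IsSupersolvable M → SSJ M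
  ssj-join : ∀ M E₁ E₂ → IsSimple M → IsRoundModularJoin M E₁ E₂ →
             SSJ (M ∣ E₁) → SSJ (M ∣ E₂) → SSJ M

{-# OPTIONS --safe #-}

-- Both classes are closed under round modular joins.  A supersolvable matroid of positive rank has a
-- modular coatom whose restriction is again supersolvable, and induction on the rank puts it in ME.
--
-- Conversely, let X be a modular coatom of M with M|X in the smaller class.  If M|X is supersolvable,
-- append E to its chain: modularity is transitive.  Otherwise M|X is a join of E₁ and E₂ over a round
-- flat; pick e ∉ X.  As every line outside X meets X in E₁ ∪ E₂, for some i the flat
-- F = cl (Eᵢ ∪ e) contains all of E ∖ X, say i = 1.  Then F is modular with F ∩ X = E₁, so M is the
-- join of F and E₂ over the same round flat, and E₁ is a modular coatom of M|F, so that induction on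
-- the way M|X was built applies to M|F.
module Submission where

open import Defs
open import Data.Bool.Properties using (T-≡)
open import Data.Empty using (⊥-elim)
open import Data.Fin using (Fin; zero; suc; fromℕ; inject₁)
open import Data.Fin.Properties using (any?) renaming (_≟_ to _≟ᶠ_)
open import Data.Fin.Subset
  using (Subset; _∈_; _∉_; _⊆_; _⊂_; _∪_; _∩_; ⁅_⁆; inside; outside)
  renaming (⊥ to ∅)
open import Data.Fin.Subset.Properties
open import Data.Nat using (ℕ; zero; suc; _+_; _≤_; _<_)
open import Data.Nat.Properties
  using (≤-refl; ≤-reflexive; ≤-trans; ≤-antisym; ≤-pred; ≰⇒>; <⇒≱; n≤0⇒n≡0;
         +-comm; +-suc; +-mono-≤; +-monoʳ-≤;
         +-cancelʳ-≤; +-cancelˡ-≤; m≤m+n; ≡ᵇ⇒≡; ≡⇒≡ᵇ; module ≤-Reasoning)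
open import Data.Nat.Tactic.RingSolver using (solve-∀)
open import Data.Product using (∃; _×_; _,_; proj₁; proj₂)
open import Data.Sum using (_⊎_; inj₁; inj₂; [_,_]′)
import Data.Sum as Sum
open import Data.Vec using ([]; _∷_; lookup)
open import Data.Vec.Properties using ([]=⇒lookup; lookup⇒[]=; lookup∘tabulate)
open import Function using (_∘_; id)
open import Function.Bundles using (Equivalence)
open import Relation.Nullary using (yes; no; ¬?; _×-dec_; contradiction)
open import Relation.Nullary.Decidable using (decidable-stable)
open import Relation.Binary.PropositionalEquality

private
  variable
    n k : ℕ
    A B C : Subset n
    e f : Fin n

-- Finite subsets.

⊆-or-witness : (A B : Subset n) → A ⊆ B ⊎ ∃ λ e → e ∈ A × e ∉ B
⊆-or-witness A B with any? (λ e → (e ∈? A) ×-dec ¬? (e ∈? B))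
... | yes w = inj₂ w
... | no ¬w = inj₁ λ {e} e∈A → decidable-stable (e ∈? B) λ e∉B → ¬w (e , e∈A , e∉B)

∪-lub : A ⊆ C → B ⊆ C → A ∪ B ⊆ C
∪-lub {A = A} {B = B} A⊆C B⊆C = [ A⊆C , B⊆C ]′ ∘ x∈p∪q⁻ A B

∩-glb : C ⊆ A → C ⊆ B → C ⊆ A ∩ B
∩-glb C⊆A C⊆B x∈C = x∈p∩q⁺ (C⊆A x∈C , C⊆B x∈C)

∪-mono : ∀ {A′ B′ : Subset n} → A ⊆ A′ → B ⊆ B′ → A ∪ B ⊆ A′ ∪ B′
∪-mono {A = A} {B = B} {A′} {B′} A⊆ B⊆ =
  ∪-lub {A = A} {B = B} (p⊆p∪q B′ ∘ A⊆) (q⊆p∪q A′ B′ ∘ B⊆)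

⁅⁆-⊆ : e ∈ A → ⁅ e ⁆ ⊆ A
⁅⁆-⊆ {e = e} {A = A} e∈A x∈ = subst (_∈ A) (sym (x∈⁅y⁆⇒x≡y e x∈)) e∈A

insert-⊆ : A ⊆ C → e ∈ C → A ∪ ⁅ e ⁆ ⊆ C
insert-⊆ {A = A} A⊆C e∈C = ∪-lub {A = A} A⊆C (⁅⁆-⊆ e∈C)

∈-insert : (A : Subset n) (e : Fin n) → e ∈ A ∪ ⁅ e ⁆
∈-insert A e = q⊆p∪q A ⁅ e ⁆ (x∈⁅x⁆ e)

insert-induction : (P : Subset n → Set) → P ∅ → (∀ S e → P S → P (S ∪ ⁅ e ⁆)) → ∀ S → P S
insert-induction {zero}  P base step []            = base
insert-induction {suc n} P base step (outside ∷ S) =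
  insert-induction (λ S → P (outside ∷ S)) base (λ S e → step (outside ∷ S) (suc e)) S
insert-induction {suc n} P base step (inside ∷ S)  =
  -- The union `(outside ∷ S) ∪ ⁅ zero ⁆` computes to `inside ∷ (S ∪ ∅)`, whence the rewriting.
  subst (λ S → P (inside ∷ S)) (∪-identityʳ S)
    (step (outside ∷ S) zero
      (insert-induction (λ S → P (outside ∷ S)) base (λ S e → step (outside ∷ S) (suc e)) S))

-- Rank, closure, flats and modularity in a fixed matroid.

module Matroid {n : ℕ} {M : Pre n} (isM : IsMatroid M) where
  open IsMatroid isM

  private
    variable
      F G X Y Z : Subset n

  r∅≡0 : r M ∅ ≡ 0
  r∅≡0 = n≤0⇒n≡0 (≤-trans (r-card ∅ (⊆-min _)) (≤-reflexive (∣⊥∣≡0 n)))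

  r-submod-≤ : ∀ {U I} → A ⊆ E M → B ⊆ E M → U ⊆ A ∪ B → I ⊆ A → I ⊆ B →
               r M U + r M I ≤ r M A + r M B
  r-submod-≤ {A = A} {B = B} A⊆E B⊆E U⊆ I⊆A I⊆B = ≤-trans
    (+-mono-≤ (r-mono _ _ (∪-lub {A = A} A⊆E B⊆E) U⊆)
              (r-mono _ _ (A⊆E ∘ p∩q⊆p A B) (∩-glb I⊆A I⊆B)))
    (r-submod _ _ A⊆E B⊆E)

  r-insert-≤ : A ⊆ E M → e ∈ E M → r M (A ∪ ⁅ e ⁆) ≤ suc (r M A)
  r-insert-≤ {A = A} {e = e} A⊆E e∈E = begin
    r M (A ∪ ⁅ e ⁆)            ≤⟨ m≤m+n _ _ ⟩
    r M (A ∪ ⁅ e ⁆) + r M ∅    ≤⟨ r-submod-≤ {B = ⁅ e ⁆} A⊆E (⁅⁆-⊆ e∈E) id (⊆-min _) (⊆-min _) ⟩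
    r M A + r M ⁅ e ⁆          ≤⟨ +-monoʳ-≤ (r M A) (r-card _ (⁅⁆-⊆ e∈E)) ⟩
    r M A + _                  ≡⟨ cong (r M A +_) (∣⁅x⁆∣≡1 e) ⟩
    r M A + 1                  ≡⟨ +-comm _ 1 ⟩
    suc (r M A)                ∎
    where open ≤-Reasoning

  -- Submodularity for `B` and `A ∪ ⁅ e ⁆`: both contain `A`, and together they contain `B ∪ ⁅ e ⁆`.
  absorb-mono : A ⊆ B → B ⊆ E M → e ∈ E M → r M (A ∪ ⁅ e ⁆) ≤ r M A → r M (B ∪ ⁅ e ⁆) ≤ r M B
  absorb-mono {A = A} {B = B} {e = e} A⊆B B⊆E e∈E absorbed = +-cancelʳ-≤ (r M A) _ _ (≤-trans
    (r-submod-≤ {A = B} {B = A ∪ ⁅ e ⁆} B⊆E (insert-⊆ (B⊆E ∘ A⊆B) e∈E)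
      (∪-mono {A = B} id (q⊆p∪q A ⁅ e ⁆)) A⊆B (p⊆p∪q ⁅ e ⁆))
    (+-monoʳ-≤ (r M B) absorbed))

  -- The points of `B` are added to `A` one at a time; by `absorb-mono`, a point that gains nothing
  -- over `A` gains nothing over the larger set.
  absorb-all : A ⊆ E M → B ⊆ E M → (∀ e → e ∈ B → r M (A ∪ ⁅ e ⁆) ≤ r M A) →
               r M (A ∪ B) ≤ r M A
  absorb-all {A = A} {B = B} A⊆E B⊆E absorbed = insert-induction
    (λ S → S ⊆ B → r M (A ∪ S) ≤ r M A)
    (λ _ → ≤-reflexive (cong (r M) (∪-identityʳ A)))
    (λ S e ih S+e⊆B →
      let S⊆B : S ⊆ B
          S⊆B = S+e⊆B ∘ p⊆p∪q ⁅ e ⁆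
          e∈B = S+e⊆B (∈-insert S e)
      in ≤-trans (≤-reflexive (cong (r M) (sym (∪-assoc A S ⁅ e ⁆))))
         (≤-trans (absorb-mono (p⊆p∪q S) (∪-lub {A = A} A⊆E (B⊆E ∘ S⊆B)) (B⊆E e∈B) (absorbed e e∈B))
                  (ih S⊆B)))
    B id

  ∈cl⁻ : ∀ A → e ∈ cl M A → e ∈ E M × r M (A ∪ ⁅ e ⁆) ≡ r M A
  ∈cl⁻ {e = e} A e∈cl
    -- The test inside `cl` is stuck on `e ∈? E M`; `t` exposes it before the case split, so that it
    -- reduces in each branch.
    with t ← trans (sym (lookup∘tabulate _ e)) ([]=⇒lookup e∈cl)
    with e ∈? E M
  ... | yes e∈E = e∈E , ≡ᵇ⇒≡ _ _ (Equivalence.from T-≡ t)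
  ... | no  _   = contradiction t λ ()

  ∈cl⁺ : ∀ A → e ∈ E M → r M (A ∪ ⁅ e ⁆) ≡ r M A → e ∈ cl M A
  ∈cl⁺ {e = e} A e∈E eq
    with t ← trans (sym (lookup∘tabulate _ e)) (refl {x = lookup (cl M A) e})
    with e ∈? E M
  ... | yes _  = lookup⇒[]= e _ (trans (sym t) (Equivalence.to T-≡ (≡⇒≡ᵇ _ _ eq)))
  ... | no e∉E = contradiction e∈E e∉E

  ∈cl : A ⊆ E M → e ∈ E M → r M (A ∪ ⁅ e ⁆) ≤ r M A → e ∈ cl M A
  ∈cl {A = A} {e = e} A⊆E e∈E absorbed = ∈cl⁺ A e∈E
    (≤-antisym absorbed (r-mono _ _ (insert-⊆ A⊆E e∈E) (p⊆p∪q ⁅ e ⁆)))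

  cl⊆E : ∀ A → cl M A ⊆ E M
  cl⊆E A = proj₁ ∘ ∈cl⁻ A

  ⊆cl : A ⊆ E M → A ⊆ cl M A
  ⊆cl A⊆E e∈A = ∈cl A⊆E (A⊆E e∈A) (r-mono _ _ A⊆E (insert-⊆ id e∈A))

  r-cl : A ⊆ E M → r M (cl M A) ≡ r M A
  r-cl {A = A} A⊆E = ≤-antisym
    (≤-trans (r-mono _ _ (∪-lub {A = A} A⊆E (cl⊆E A)) (q⊆p∪q A (cl M A)))
             (absorb-all A⊆E (cl⊆E A) λ e e∈cl → ≤-reflexive (proj₂ (∈cl⁻ A e∈cl))))
    (r-mono _ _ (cl⊆E A) (⊆cl A⊆E))

  cl-flat : A ⊆ E M → IsFlat M (cl M A)
  cl-flat {A = A} A⊆E = cl⊆E A , λ e e∈E e∉cl eq → e∉cl (∈cl A⊆E e∈E (begin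
    r M (A ∪ ⁅ e ⁆)       ≤⟨ r-mono _ _ (insert-⊆ (cl⊆E A) e∈E) (∪-mono {A = A} (⊆cl A⊆E) id) ⟩
    r M (cl M A ∪ ⁅ e ⁆)  ≡⟨ eq ⟨
    r M (cl M A)          ≡⟨ r-cl A⊆E ⟩
    r M A                 ∎))
    where open ≤-Reasoning

  -- By `absorb-mono`, such a point gains nothing over `F` either, and no point outside a flat does
  -- that.
  flat-absorbs : IsFlat M F → A ⊆ F → e ∈ E M → r M (A ∪ ⁅ e ⁆) ≤ r M A → e ∈ F
  flat-absorbs {F = F} {e = e} (F⊆E , maximal) A⊆F e∈E absorbed with e ∈? F
  ... | yes e∈F = e∈F
  ... | no  e∉F = ⊥-elim (maximal e e∈E e∉F (≤-antisym
    (r-mono _ _ (insert-⊆ F⊆E e∈E) (p⊆p∪q ⁅ e ⁆))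
    (absorb-mono A⊆F F⊆E e∈E absorbed)))

  r-gain : IsFlat M F → A ⊆ F → e ∈ E M → e ∉ F → r M A < r M (A ∪ ⁅ e ⁆)
  r-gain flat A⊆F e∈E e∉F = ≰⇒> (e∉F ∘ flat-absorbs flat A⊆F e∈E)

  cl⊆flat : IsFlat M F → A ⊆ F → cl M A ⊆ F
  cl⊆flat {A = A} flat A⊆F e∈cl =
    flat-absorbs flat A⊆F (cl⊆E A e∈cl) (≤-reflexive (proj₂ (∈cl⁻ A e∈cl)))

  -- Steinitz exchange: `F` with both points has rank at most `suc (r M F)`, and `f` alone already
  -- reaches this rank over `F`.
  cl-exchange : IsFlat M F → e ∈ E M → f ∉ F → f ∈ cl M (F ∪ ⁅ e ⁆) → e ∈ cl M (F ∪ ⁅ f ⁆)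
  cl-exchange {F = F} {e = e} {f = f} flat@(F⊆E , _) e∈E f∉F f∈cl = ∈cl F+f⊆E e∈E (begin
    r M ((F ∪ ⁅ f ⁆) ∪ ⁅ e ⁆)  ≡⟨ cong (r M) swap ⟩
    r M ((F ∪ ⁅ e ⁆) ∪ ⁅ f ⁆)  ≡⟨ proj₂ (∈cl⁻ (F ∪ ⁅ e ⁆) f∈cl) ⟩
    r M (F ∪ ⁅ e ⁆)            ≤⟨ r-insert-≤ F⊆E e∈E ⟩
    suc (r M F)                ≤⟨ r-gain flat id f∈E f∉F ⟩
    r M (F ∪ ⁅ f ⁆)            ∎)
    where
    open ≤-Reasoning
    f∈E = cl⊆E _ f∈cl
    F+f⊆E : F ∪ ⁅ f ⁆ ⊆ E M
    F+f⊆E = insert-⊆ F⊆E f∈E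
    swap : (F ∪ ⁅ f ⁆) ∪ ⁅ e ⁆ ≡ (F ∪ ⁅ e ⁆) ∪ ⁅ f ⁆
    swap = trans (∪-assoc F _ _) (trans (cong (F ∪_) (∪-comm ⁅ f ⁆ ⁅ e ⁆)) (sym (∪-assoc F _ _)))

  ∩-flat : IsFlat M F → IsFlat M G → IsFlat M (F ∩ G)
  ∩-flat {F} {G} flatF flatG = proj₁ flatF ∘ p∩q⊆p F G , λ e e∈E e∉ eq →
    let absorbed = ≤-reflexive (sym eq) in
    e∉ (x∈p∩q⁺ (flat-absorbs flatF (p∩q⊆p F G) e∈E absorbed ,
                flat-absorbs flatG (p∩q⊆q F G) e∈E absorbed))

  E-flat : IsFlat M (E M)
  E-flat = id , λ e e∈E e∉E → contradiction e∈E e∉E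

  flat-<-rank : IsFlat M F → G ⊆ E M → F ⊂ G → r M F < r M G
  flat-<-rank flat G⊆E (F⊆G , e , e∈G , e∉F) =
    ≤-trans (r-gain flat id (G⊆E e∈G) e∉F) (r-mono _ _ G⊆E (insert-⊆ F⊆G e∈G))

  -- Flatness in `M ∣ X` is silent about points outside `X`; but a point that gains nothing over `F`
  -- lies in the flat `X`.
  flat-of-flat : IsFlat M X → IsFlat (M ∣ X) F → IsFlat M F
  flat-of-flat {X} {F} flatX (F⊆X , maximal) = proj₁ flatX ∘ F⊆X , λ e e∈E e∉F eq →
    maximal e (flat-absorbs flatX F⊆X e∈E (≤-reflexive (sym eq))) e∉F eq

  restrict-flat : X ⊆ E M → IsFlat M F → F ⊆ X → IsFlat (M ∣ X) F
  restrict-flat X⊆E (_ , maximal) F⊆X = F⊆X , λ e → maximal e ∘ X⊆E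

  restrict : X ⊆ E M → IsMatroid (M ∣ X)
  restrict X⊆E = record
    { r-card   = λ A A⊆X → r-card A (X⊆E ∘ A⊆X)
    ; r-mono   = λ A B B⊆X → r-mono A B (X⊆E ∘ B⊆X)
    ; r-submod = λ A B A⊆X B⊆X → r-submod A B (X⊆E ∘ A⊆X) (X⊆E ∘ B⊆X)
    }

  modular-rank : IsModularFlat M X → IsFlat M Y → r M X + r M Y ≡ r M (X ∩ Y) + r M (X ∪ Y)
  modular-rank {X} {Y} ((X⊆E , _) , modular) flatY@(Y⊆E , _) =
    trans (modular Y flatY) (cong (r M (X ∩ Y) +_) (r-cl (∪-lub {A = X} X⊆E Y⊆E)))

  -- The reverse inequality is submodularity. Using the union instead of its closure keeps the rank
  -- and avoids comparing closures in different restrictions.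
  mkModular : IsFlat M X → (∀ Y → IsFlat M Y → r M X + r M Y ≤ r M (X ∩ Y) + r M (X ∪ Y)) →
              IsModularFlat M X
  mkModular {X} flatX@(X⊆E , _) modular = flatX , λ Y flatY@(Y⊆E , _) →
    trans (≤-antisym (modular Y flatY)
             (≤-trans (≤-reflexive (+-comm (r M (X ∩ Y)) _)) (r-submod X Y X⊆E Y⊆E)))
          (cong (r M (X ∩ Y) +_) (sym (r-cl (∪-lub {A = X} X⊆E Y⊆E))))

  E-modular : IsModularFlat M (E M)
  E-modular = mkModular E-flat λ Y (Y⊆E , _) → ≤-trans (≤-reflexive (+-comm (r M (E M)) _))
    (+-mono-≤ (r-mono _ _ (p∩q⊆p (E M) Y) (∩-glb Y⊆E id))
              (r-mono _ _ (∪-lub {A = E M} id Y⊆E) (p⊆p∪q Y)))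

open Matroid

-- Modular flats under restriction.

restrict-modular : {M : Pre n} → IsMatroid M → ∀ {X Y} → X ⊆ E M → Y ⊆ X → IsFlat M X →
                   IsModularFlat M Y → IsModularFlat (M ∣ X) Y
restrict-modular isM X⊆E Y⊆X flatX modY = mkModular (restrict isM X⊆E)
  (restrict-flat isM X⊆E (proj₁ modY) Y⊆X)
  λ Z flatZ → ≤-reflexive (modular-rank isM modY (flat-of-flat isM flatX flatZ))

-- Add the equations for `Y` against `X ∩ Z` inside `X` and for `X` against `Z`, then compare with
-- the equation for `X` against `J`: the set `Y ∪ (X ∩ Z)` lies in `X ∩ J`, and `X ∪ Z` in `X ∪ J`.
modular-trans : {M : Pre n} → IsMatroid M → ∀ {X Y} →
                IsModularFlat M X → IsModularFlat (M ∣ X) Y → IsModularFlat M Y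
modular-trans {M = M} isM {X} {Y} modX@(flatX@(X⊆E , _) , _) modY@(flatY@(Y⊆X , _) , _) =
  mkModular isM (flat-of-flat isM flatX flatY) λ Z flatZ@(Z⊆E , _) →
  let YZ⊆E : Y ∪ Z ⊆ E M
      YZ⊆E = ∪-lub {A = Y} (X⊆E ∘ Y⊆X) Z⊆E
      J = cl M (Y ∪ Z)
      YZ⊆J : Y ∪ Z ⊆ J
      YZ⊆J = ⊆cl isM YZ⊆E
      Z⊆J : Z ⊆ J
      Z⊆J = YZ⊆J ∘ q⊆p∪q Y Z
      J⊆E : J ⊆ E M
      J⊆E = cl⊆E isM (Y ∪ Z)
      X∩Z-flat = restrict-flat isM X⊆E (∩-flat isM flatX flatZ) (p∩q⊆p X Z)
  in +-cancelʳ-≤ (r M (X ∩ Z) + r M X) _ _ (begin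
    (r M Y + r M Z) + (r M (X ∩ Z) + r M X)
      ≡⟨ regroup (r M Y) (r M Z) (r M (X ∩ Z)) (r M X) ⟩
    (r M Y + r M (X ∩ Z)) + (r M X + r M Z)
      ≡⟨ cong₂ _+_ (modular-rank (restrict isM X⊆E) modY X∩Z-flat) (modular-rank isM modX flatZ) ⟩
    (r M (Y ∩ (X ∩ Z)) + r M (Y ∪ (X ∩ Z))) + (r M (X ∩ Z) + r M (X ∪ Z))
      ≤⟨ +-mono-≤ (+-mono-≤
           (r-mono _ _ (X⊆E ∘ Y⊆X ∘ p∩q⊆p Y Z)
             (∩-glb (p∩q⊆p Y (X ∩ Z)) (p∩q⊆q X Z ∘ p∩q⊆q Y (X ∩ Z))))
           (r-mono _ _ (J⊆E ∘ p∩q⊆q X J)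
             (∪-lub {A = Y} (∩-glb Y⊆X (YZ⊆J ∘ p⊆p∪q Z))
                            (∩-glb (p∩q⊆p X Z) (Z⊆J ∘ p∩q⊆q X Z)))))
           (+-monoʳ-≤ (r M (X ∩ Z))
             (r-mono _ _ (∪-lub {A = X} X⊆E J⊆E) (∪-mono {A = X} id Z⊆J))) ⟩
    (r M (Y ∩ Z) + r M (X ∩ J)) + (r M (X ∩ Z) + r M (X ∪ J))
      ≡⟨ regroup′ (r M (Y ∩ Z)) (r M (X ∩ J)) (r M (X ∩ Z)) (r M (X ∪ J)) ⟩
    (r M (Y ∩ Z) + r M (X ∩ Z)) + (r M (X ∩ J) + r M (X ∪ J))
      ≡⟨ cong (r M (Y ∩ Z) + r M (X ∩ Z) +_) (modular-rank isM modX (cl-flat isM YZ⊆E)) ⟨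
    (r M (Y ∩ Z) + r M (X ∩ Z)) + (r M X + r M J)
      ≡⟨ cong (λ u → (r M (Y ∩ Z) + r M (X ∩ Z)) + (r M X + u)) (r-cl isM YZ⊆E) ⟩
    (r M (Y ∩ Z) + r M (X ∩ Z)) + (r M X + r M (Y ∪ Z))
      ≡⟨ regroup″ (r M (Y ∩ Z)) (r M (X ∩ Z)) (r M X) (r M (Y ∪ Z)) ⟩
    (r M (Y ∩ Z) + r M (Y ∪ Z)) + (r M (X ∩ Z) + r M X) ∎)
  where
  open ≤-Reasoning
  open IsMatroid isM
  regroup : ∀ a b c d → (a + b) + (c + d) ≡ (a + c) + (d + b)
  regroup = solve-∀
  regroup′ : ∀ a b c d → (a + b) + (c + d) ≡ (a + c) + (b + d)
  regroup′ = solve-∀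
  regroup″ : ∀ a b c d → (a + b) + (c + d) ≡ (a + d) + (b + c)
  regroup″ = solve-∀

restrict-simple : {M : Pre n} → IsSimple M → ∀ {X} → X ⊆ E M → IsSimple (M ∣ X)
restrict-simple simple X⊆E = record
  { matroid = restrict matroid X⊆E
  ; no-loop = λ e e∈X → no-loop e (X⊆E e∈X)
  ; no-para = λ e f e∈X f∈X → no-para e f (X⊆E e∈X) (X⊆E f∈X)
  }
  where open IsSimple simple

-- Chains of modular flats and supersolvability.

-- The length is freed from the rank, to allow induction on it and transport along rank equations;
-- at `k = r M (E M)` this is definitionally `IsSupersolvable M`.
Chain : ∀ {n} → Pre n → ℕ → Set
Chain M k = ∃ λ (X : Fin (suc k) → Subset _) →
  (X zero ≡ ∅) × (X (fromℕ k) ≡ E M) ×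
  (∀ i → IsModularFlat M (X i)) × (∀ (i : Fin k) → X (inject₁ i) ⊂ X (suc i))

snoc : {S : Set} → (Fin k → S) → S → Fin (suc k) → S
snoc {zero}  f a _       = a
snoc {suc k} f a zero    = f zero
snoc {suc k} f a (suc i) = snoc (f ∘ suc) a i

module _ {S : Set} where

  snoc-last : (f : Fin k → S) (a : S) → snoc f a (fromℕ k) ≡ a
  snoc-last {zero}  f a = refl
  snoc-last {suc k} f a = snoc-last (f ∘ suc) a

  snoc-all : (P : S → Set) (f : Fin k → S) (a : S) → (∀ i → P (f i)) → P a → ∀ i → P (snoc f a i)
  snoc-all {zero}  P f a Pf Pa _       = Pa
  snoc-all {suc k} P f a Pf Pa zero    = Pf zero
  snoc-all {suc k} P f a Pf Pa (suc i) = snoc-all P (f ∘ suc) a (Pf ∘ suc) Pa i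

  snoc-steps : (R : S → S → Set) (f : Fin (suc k) → S) (a : S) →
               (∀ i → R (f (inject₁ i)) (f (suc i))) → R (f (fromℕ k)) a →
               ∀ i → R (snoc f a (inject₁ i)) (snoc f a (suc i))
  snoc-steps {zero}  R f a steps last zero    = last
  snoc-steps {suc k} R f a steps last zero    = steps zero
  snoc-steps {suc k} R f a steps last (suc i) = snoc-steps R (f ∘ suc) a (steps ∘ suc) last i

steps-⊆-last : (f : Fin (suc k) → Subset n) → (∀ i → f (inject₁ i) ⊆ f (suc i)) →
               ∀ i → f i ⊆ f (fromℕ k)
steps-⊆-last {zero}  f steps zero    = id
steps-⊆-last {suc k} f steps zero    = steps-⊆-last (f ∘ suc) (λ i → steps (suc i)) zero ∘ steps zero
steps-⊆-last {suc k} f steps (suc i) = steps-⊆-last (f ∘ suc) (λ i → steps (suc i)) i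

steps-<-last : (f : Fin (suc k) → ℕ) → (∀ i → f (inject₁ i) < f (suc i)) →
               k + f zero ≤ f (fromℕ k)
steps-<-last {zero}  f steps = ≤-refl
steps-<-last {suc k} f steps = ≤-trans
  (≤-trans (≤-reflexive (sym (+-suc k _))) (+-monoʳ-≤ k (steps zero)))
  (steps-<-last (f ∘ suc) (steps ∘ suc))

coatom-⊂ : {M : Pre n} → IsMatroid M → ∀ {X} → IsCoatom M X → X ⊂ E M
coatom-⊂ {M = M} isM {X} ((X⊆E , _) , rX) with ⊆-or-witness (E M) X
... | inj₁ E⊆X = contradiction (≤-trans (≤-reflexive rX) (IsMatroid.r-mono isM _ _ X⊆E E⊆X)) (<⇒≱ ≤-refl)
... | inj₂ w   = X⊆E , w

coatom-supersolvable : {M : Pre n} → IsMatroid M → ∀ {X} → IsCoatom M X → IsModularFlat M X →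
                       IsSupersolvable (M ∣ X) → IsSupersolvable M
coatom-supersolvable {M = M} isM {X} coatom modX (Xs , first , last , mods , steps) =
  -- The chain of `M ∣ X` has length `r M X`; the coatom equation turns its successor into
  -- `r M (E M)`.
  subst (Chain M) (proj₂ coatom)
    ( snoc Xs (E M)
    , first
    , snoc-last Xs (E M)
    , snoc-all (IsModularFlat M) Xs (E M) (λ i → modular-trans isM modX (mods i)) (E-modular isM)
    , snoc-steps _⊂_ Xs (E M) steps (subst (_⊂ E M) (sym last) (coatom-⊂ isM coatom)) )

-- Extending one side of a join past a modular coatom.

module _ {M : Pre n} (isM : IsMatroid M) {X E₁ : Subset n}
         (coatom : IsCoatom M X) (modX : IsModularFlat M X) (mod₁ : IsModularFlat (M ∣ X) E₁)
         {e : Fin n} (e∈E : e ∈ E M) (e∉X : e ∉ X) where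

  private
    open IsMatroid isM
    flatX = proj₁ modX
    X⊆E   = proj₁ flatX

    E₁⊆X : E₁ ⊆ X
    E₁⊆X = proj₁ (proj₁ mod₁)

    modM₁ : IsModularFlat M E₁
    modM₁ = modular-trans isM modX mod₁

    E₁⊆E : E₁ ⊆ E M
    E₁⊆E = X⊆E ∘ E₁⊆X

    E₁+e⊆E : E₁ ∪ ⁅ e ⁆ ⊆ E M
    E₁+e⊆E = insert-⊆ E₁⊆E e∈E

    F₁ = cl M (E₁ ∪ ⁅ e ⁆)

    E₁⊆F₁ : E₁ ⊆ F₁
    E₁⊆F₁ = ⊆cl isM E₁+e⊆E ∘ p⊆p∪q ⁅ e ⁆

    F₁⊆E : F₁ ⊆ E M
    F₁⊆E = cl⊆E isM (E₁ ∪ ⁅ e ⁆)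

  -- If `g` were in `F₁` and `X` but not in `E₁`, exchange would put `e` into the closure of
  -- `E₁ ∪ ⁅ g ⁆`, hence into `X`.
  extension-trace : F₁ ∩ X ⊆ E₁
  extension-trace {g} g∈ with x∈p∩q⁻ F₁ X g∈ | g ∈? E₁
  ... | _         , _   | yes g∈E₁ = g∈E₁
  ... | g∈F₁ , g∈X | no g∉E₁  = contradiction
    (cl⊆flat isM flatX (insert-⊆ E₁⊆X g∈X) (cl-exchange isM (proj₁ modM₁) e∈E g∉E₁ g∈F₁))
    e∉X

  extension-rank : suc (r M E₁) ≡ r M F₁
  extension-rank = trans
    (≤-antisym (r-gain isM flatX E₁⊆X e∈E e∉X) (r-insert-≤ isM E₁⊆E e∈E))
    (sym (r-cl isM E₁+e⊆E))

  extension-coatom : IsCoatom (M ∣ F₁) E₁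
  extension-coatom = restrict-flat isM F₁⊆E (proj₁ modM₁) E₁⊆F₁ , extension-rank

  extension-modular-coatom : IsModularFlat (M ∣ F₁) E₁
  extension-modular-coatom = restrict-modular isM F₁⊆E E₁⊆F₁ (cl-flat isM E₁+e⊆E) modM₁

  extension-modular : E M ⊆ X ∪ F₁ → IsModularFlat M F₁
  extension-modular cover = mkModular isM (cl-flat isM E₁+e⊆E) modular
    where
    open ≤-Reasoning
    modular : ∀ Y → IsFlat M Y → r M F₁ + r M Y ≤ r M (F₁ ∩ Y) + r M (F₁ ∪ Y)
    modular Y flatY@(Y⊆E , _) with ⊆-or-witness Y X
    -- Here `e` lies outside `X`, so it adds one to the rank of `E₁ ∪ Y`, matching the step from
    -- `E₁` to `F₁`.
    ... | inj₁ Y⊆X = begin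
      r M F₁ + r M Y                               ≡⟨ cong (_+ r M Y) extension-rank ⟨
      suc (r M E₁ + r M Y)                         ≡⟨ cong suc (modular-rank isM modM₁ flatY) ⟩
      suc (r M (E₁ ∩ Y) + r M (E₁ ∪ Y))            ≡⟨ +-suc (r M (E₁ ∩ Y)) _ ⟨
      r M (E₁ ∩ Y) + suc (r M (E₁ ∪ Y))            ≤⟨ +-mono-≤
        (r-mono _ _ (F₁⊆E ∘ p∩q⊆p F₁ Y) (∩-glb (E₁⊆F₁ ∘ p∩q⊆p E₁ Y) (p∩q⊆q E₁ Y)))
        (≤-trans (r-gain isM flatX (∪-lub {A = E₁} E₁⊆X Y⊆X) e∈E e∉X)
          (r-mono _ _ (∪-lub {A = F₁} F₁⊆E Y⊆E)
            (insert-⊆ (∪-mono {A = E₁} E₁⊆F₁ id)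
              (p⊆p∪q Y (⊆cl isM E₁+e⊆E (∈-insert E₁ e)))))) ⟩
      r M (F₁ ∩ Y) + r M (F₁ ∪ Y)                  ∎
    -- By `cover`, `f` lies in `F₁`. Start from the equation for `E₁` against `X ∩ Y`: passing to
    -- `F₁` and `Y` adds at most two on the left, while `f` adds one to the meet and one to the
    -- union.
    ... | inj₂ (f , f∈Y , f∉X) = begin
      r M F₁ + r M Y                               ≤⟨ +-mono-≤ (≤-reflexive (sym extension-rank)) rY≤ ⟩
      suc (r M E₁) + suc (r M (X ∩ Y))             ≡⟨ +-suc (suc (r M E₁)) _ ⟩
      suc (suc (r M E₁ + r M (X ∩ Y)))             ≡⟨ cong (2 +_) (modular-rank isM modM₁ (∩-flat isM flatX flatY)) ⟩
      suc (suc (r M (E₁ ∩ (X ∩ Y)) + r M (E₁ ∪ (X ∩ Y))))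
                                                   ≡⟨ +-suc (suc (r M (E₁ ∩ (X ∩ Y)))) _ ⟨
      suc (r M (E₁ ∩ (X ∩ Y))) + suc (r M (E₁ ∪ (X ∩ Y)))
                                                   ≤⟨ +-mono-≤
        (≤-trans (r-gain isM flatX (E₁⊆X ∘ p∩q⊆p E₁ (X ∩ Y)) (Y⊆E f∈Y) f∉X)
          (r-mono _ _ (F₁⊆E ∘ p∩q⊆p F₁ Y)
            (insert-⊆ (∩-glb (E₁⊆F₁ ∘ p∩q⊆p E₁ (X ∩ Y)) (X∩Y⊆Y ∘ p∩q⊆q E₁ (X ∩ Y)))
                      (x∈p∩q⁺ (f∈F₁ , f∈Y)))))
        (≤-trans (r-gain isM flatX (∪-lub {A = E₁} E₁⊆X (p∩q⊆p X Y)) (Y⊆E f∈Y) f∉X)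
          (r-mono _ _ (∪-lub {A = F₁} F₁⊆E Y⊆E)
            (insert-⊆ (∪-mono {A = E₁} E₁⊆F₁ X∩Y⊆Y) (p⊆p∪q Y f∈F₁)))) ⟩
      r M (F₁ ∩ Y) + r M (F₁ ∪ Y)                  ∎
      where
      X∩Y⊆Y : X ∩ Y ⊆ Y
      X∩Y⊆Y = p∩q⊆q X Y
      f∈F₁ : f ∈ F₁
      f∈F₁ = [ (λ f∈X → contradiction f∈X f∉X) , id ]′ (x∈p∪q⁻ X F₁ (cover (Y⊆E f∈Y)))
      rY≤ : r M Y ≤ suc (r M (X ∩ Y))
      -- Modularity of `X` against `Y`, where the union has rank at most `suc (r M X)` because `X`
      -- is a coatom.
      rY≤ = +-cancelˡ-≤ (r M X) _ _ (begin
        r M X + r M Y                  ≡⟨ modular-rank isM modX flatY ⟩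
        r M (X ∩ Y) + r M (X ∪ Y)      ≤⟨ +-monoʳ-≤ (r M (X ∩ Y)) (r-mono _ _ id (∪-lub {A = X} X⊆E Y⊆E)) ⟩
        r M (X ∩ Y) + r M (E M)        ≡⟨ cong (r M (X ∩ Y) +_) (proj₂ coatom) ⟨
        r M (X ∩ Y) + suc (r M X)      ≡⟨ shift (r M (X ∩ Y)) (r M X) ⟩
        r M X + suc (r M (X ∩ Y))      ∎)
        where
        shift : ∀ a b → a + suc b ≡ b + suc a
        shift = solve-∀

  -- By `extension-trace`, `F₁` meets `X` only in `E₁`. So `F₁` is proper because `E₁` is proper in
  -- `X`, and `F₁ ∩ E₂` is the old round intersection.
  extension-join : ∀ {E₂} → IsModularFlat (M ∣ X) E₂ → E₁ ≢ X → E₁ ∪ E₂ ≡ X →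
                   IsRound (M ∣ (E₁ ∩ E₂)) → E M ⊆ X ∪ F₁ → IsRoundModularJoin M F₁ E₂
  extension-join {E₂} mod₂ E₁≢X union round cover =
      extension-modular cover
    , modular-trans isM modX mod₂
    , (λ F₁≡E → E₁≢X (⊆-antisym E₁⊆X λ x∈X →
        extension-trace (x∈p∩q⁺ (subst (_ ∈_) (sym F₁≡E) (X⊆E x∈X) , x∈X))))
    , (λ E₂≡E → e∉X (E₂⊆X (subst (e ∈_) (sym E₂≡E) e∈E)))
    , ⊆-antisym (∪-lub {A = F₁} F₁⊆E (X⊆E ∘ E₂⊆X))
        (∪-lub {A = X} X⊆F₁∪E₂ (p⊆p∪q E₂) ∘ cover)
    , subst (λ Z → IsRound (M ∣ Z)) (⊆-antisym
        (∩-glb (E₁⊆F₁ ∘ p∩q⊆p E₁ E₂) (p∩q⊆q E₁ E₂))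
        (∩-glb (λ x∈ → extension-trace (∩-glb (p∩q⊆p F₁ E₂) (E₂⊆X ∘ p∩q⊆q F₁ E₂) x∈))
               (p∩q⊆q F₁ E₂))) round
    where
    E₂⊆X : E₂ ⊆ X
    E₂⊆X = proj₁ (proj₁ mod₂)
    X⊆F₁∪E₂ : X ⊆ F₁ ∪ E₂
    X⊆F₁∪E₂ = subst (_⊆ F₁ ∪ E₂) union (∪-mono {A = E₁} E₁⊆F₁ id)

-- The line through e and f meets the modular coatom X in a point p ∈ E₁ ∪ E₂; if p ∈ Eᵢ then
-- e and p, hence e and Eᵢ, span f.
line-through-coatom : {M : Pre n} → IsSimple M → ∀ {X E₁ E₂} → IsCoatom M X → IsModularFlat M X →
  E₁ ∪ E₂ ≡ X → e ∈ E M → e ∉ X → f ∈ E M → f ∉ X →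
  f ∈ cl M (E₁ ∪ ⁅ e ⁆) ⊎ f ∈ cl M (E₂ ∪ ⁅ e ⁆)
line-through-coatom {e = e} {f = f} {M = M} simple {X} {E₁} {E₂} coatom modX union e∈E e∉X f∈E f∉X
  with e ≟ᶠ f
... | yes refl = inj₁ (⊆cl matroid (insert-⊆ E₁⊆E e∈E) (∈-insert E₁ e))
  where
  open IsSimple simple
  E₁⊆E : E₁ ⊆ E M
  E₁⊆E = proj₁ (proj₁ modX) ∘ subst (E₁ ⊆_) union (p⊆p∪q E₂)
... | no e≢f with ⊆-or-witness (X ∩ cl M (⁅ e ⁆ ∪ ⁅ f ⁆)) ∅
-- If the line missed `X`, modularity would bound its rank by the corank of `X`, which is 1.
...   | inj₁ empty = contradiction rL≤1 (<⇒≱ (≤-reflexive (sym rL)))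
  where
  open IsSimple simple
  open IsMatroid matroid
  open ≤-Reasoning
  X⊆E = proj₁ (proj₁ modX)
  L = cl M (⁅ e ⁆ ∪ ⁅ f ⁆)
  ef⊆E : ⁅ e ⁆ ∪ ⁅ f ⁆ ⊆ E M
  ef⊆E = insert-⊆ (⁅⁆-⊆ e∈E) f∈E
  rL : r M L ≡ 2
  rL = trans (r-cl matroid ef⊆E) (no-para e f e∈E f∈E e≢f)
  rL≤1 : r M L ≤ 1
  rL≤1 = +-cancelˡ-≤ (r M X) _ _ (begin
    r M X + r M L              ≡⟨ modular-rank matroid modX (cl-flat matroid ef⊆E) ⟩
    r M (X ∩ L) + r M (X ∪ L)  ≤⟨ +-mono-≤
      (≤-trans (r-mono _ _ (⊆-min _) empty) (≤-reflexive (r∅≡0 matroid)))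
      (r-mono _ _ id (∪-lub {A = X} X⊆E (cl⊆E matroid (⁅ e ⁆ ∪ ⁅ f ⁆)))) ⟩
    r M (E M)                  ≡⟨ proj₂ coatom ⟨
    suc (r M X)                ≡⟨ +-comm 1 (r M X) ⟩
    r M X + 1                  ∎)
...   | inj₂ (p , p∈ , _) =
  Sum.map (spanned (p⊆p∪q E₂)) (spanned (q⊆p∪q E₁ E₂)) (x∈p∪q⁻ E₁ E₂ (subst (p ∈_) (sym union) p∈X))
  where
  open IsSimple simple
  open IsMatroid matroid
  open ≤-Reasoning
  X⊆E = proj₁ (proj₁ modX)
  L = cl M (⁅ e ⁆ ∪ ⁅ f ⁆)
  L⊆E : L ⊆ E M
  L⊆E = cl⊆E matroid (⁅ e ⁆ ∪ ⁅ f ⁆)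
  ef⊆E : ⁅ e ⁆ ∪ ⁅ f ⁆ ⊆ E M
  ef⊆E = insert-⊆ (⁅⁆-⊆ e∈E) f∈E
  ef⊆L : ⁅ e ⁆ ∪ ⁅ f ⁆ ⊆ L
  ef⊆L = ⊆cl matroid ef⊆E
  p∈X : p ∈ X
  p∈X = p∩q⊆p X L p∈
  p∈L : p ∈ L
  p∈L = p∩q⊆q X L p∈
  e≢p : e ≢ p
  e≢p e≡p = e∉X (subst (_∈ X) (sym e≡p) p∈X)
  absorbed : r M ((⁅ e ⁆ ∪ ⁅ p ⁆) ∪ ⁅ f ⁆) ≤ r M (⁅ e ⁆ ∪ ⁅ p ⁆)
  absorbed = begin
    r M ((⁅ e ⁆ ∪ ⁅ p ⁆) ∪ ⁅ f ⁆)  ≤⟨ r-mono _ _ L⊆E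
      (insert-⊆ (insert-⊆ (ef⊆L ∘ p⊆p∪q ⁅ f ⁆) p∈L) (ef⊆L (∈-insert ⁅ e ⁆ f))) ⟩
    r M L                          ≡⟨ r-cl matroid ef⊆E ⟩
    r M (⁅ e ⁆ ∪ ⁅ f ⁆)            ≡⟨ no-para e f e∈E f∈E e≢f ⟩
    2                              ≡⟨ no-para e p e∈E (X⊆E p∈X) e≢p ⟨
    r M (⁅ e ⁆ ∪ ⁅ p ⁆)            ∎
  spanned : ∀ {D} → D ⊆ E₁ ∪ E₂ → p ∈ D → f ∈ cl M (D ∪ ⁅ e ⁆)
  spanned {D} D⊆ p∈D = ∈cl matroid D+e⊆E f∈E (absorb-mono matroid
    (insert-⊆ (q⊆p∪q D ⁅ e ⁆) (p⊆p∪q ⁅ e ⁆ p∈D)) D+e⊆E f∈E absorbed)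
    where
    D+e⊆E : D ∪ ⁅ e ⁆ ⊆ E M
    D+e⊆E = insert-⊆ (X⊆E ∘ subst (D ⊆_) union D⊆) e∈E

-- On the points outside X, "f ∈ cl (Eᵢ ∪ e)" is an equivalence relation for i = 1, 2.  Together the
-- two relations hold of every pair, and of two such equivalences one is total.
one-side-covers : {M : Pre n} → IsSimple M → ∀ {X E₁ E₂} → IsCoatom M X → IsModularFlat M X →
  IsFlat M E₁ → IsFlat M E₂ → E₁ ∪ E₂ ≡ X → e ∈ E M → e ∉ X →
  E M ⊆ X ∪ cl M (E₁ ∪ ⁅ e ⁆) ⊎ E M ⊆ X ∪ cl M (E₂ ∪ ⁅ e ⁆)
one-side-covers {e = e} {M = M} simple {X} {E₁} {E₂} coatom modX flat₁ flat₂ union e∈E e∉X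
  with ⊆-or-witness (E M) (X ∪ cl M (E₁ ∪ ⁅ e ⁆)) | ⊆-or-witness (E M) (X ∪ cl M (E₂ ∪ ⁅ e ⁆))
... | inj₁ cover | _ = inj₁ cover
... | _ | inj₁ cover = inj₂ cover
-- Since `f` is unrelated to `e` on side 1 and `g` on side 2, `e` is related to `g` on side 1 and to
-- `f` on side 2. Whichever side relates `f` to `g` then yields a contradiction by transitivity.
... | inj₂ (f , f∈E , f∉) | inj₂ (g , g∈E , g∉) = ⊥-elim
  ([ (λ g∈ → f∉ (q⊆p∪q X _ (join-∈ flat₁ e~₁g (cl-exchange matroid flat₁ f∈E (g∉X ∘ E₁⊆X) g∈))))
   , (λ g∈ → g∉ (q⊆p∪q X _ (join-∈ flat₂ e~₂f g∈))) ]′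
   (line f∈E f∉X g∈E g∉X))
  where
  open IsSimple simple
  line : ∀ {e f} → e ∈ E M → e ∉ X → f ∈ E M → f ∉ X →
         f ∈ cl M (E₁ ∪ ⁅ e ⁆) ⊎ f ∈ cl M (E₂ ∪ ⁅ e ⁆)
  line = line-through-coatom simple coatom modX union
  E₁⊆X : E₁ ⊆ X
  E₁⊆X = subst (E₁ ⊆_) union (p⊆p∪q E₂)
  f∉X : f ∉ X
  f∉X = f∉ ∘ p⊆p∪q _
  g∉X : g ∉ X
  g∉X = g∉ ∘ p⊆p∪q _
  e~₁g : g ∈ cl M (E₁ ∪ ⁅ e ⁆)
  e~₁g = [ id , (λ g∈ → contradiction (q⊆p∪q X _ g∈) g∉) ]′ (line e∈E e∉X g∈E g∉X)
  e~₂f : f ∈ cl M (E₂ ∪ ⁅ e ⁆)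
  e~₂f = [ (λ f∈ → contradiction (q⊆p∪q X _ f∈) f∉) , id ]′ (line e∈E e∉X f∈E f∉X)
  join-∈ : ∀ {D y z} → IsFlat M D → y ∈ cl M (D ∪ ⁅ e ⁆) → z ∈ cl M (D ∪ ⁅ y ⁆) → z ∈ cl M (D ∪ ⁅ e ⁆)
  join-∈ {D} (D⊆E , _) y∈ = cl⊆flat matroid (cl-flat matroid D+e⊆E)
    (insert-⊆ (⊆cl matroid D+e⊆E ∘ p⊆p∪q ⁅ e ⁆) y∈)
    where
    D+e⊆E : D ∪ ⁅ e ⁆ ⊆ E M
    D+e⊆E = insert-⊆ D⊆E e∈E

-- From `ME` to round joins of supersolvable matroids.

coatom-extension : {M : Pre n} → IsSimple M → ∀ {X} → IsCoatom M X → IsModularFlat M X →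
                   SSJ (M ∣ X) → SSJ M
coatom-extension {M = M} simple coatom modX (ssj-ss _ _ supersolvable) =
  ssj-ss M simple (coatom-supersolvable (IsSimple.matroid simple) coatom modX supersolvable)
coatom-extension {M = M} simple {X} coatom modX
  (ssj-join _ E₁ E₂ _ (mod₁ , mod₂ , E₁≢X , E₂≢X , union , round) d₁ d₂)
  with (_ , e , e∈E , e∉X) ← coatom-⊂ (IsSimple.matroid simple) coatom
  with one-side-covers simple coatom modX (flat-of-flat (IsSimple.matroid simple) (proj₁ modX) (proj₁ mod₁))
         (flat-of-flat (IsSimple.matroid simple) (proj₁ modX) (proj₁ mod₂)) union e∈E e∉X
... | inj₁ cover = ssj-join M (cl M (E₁ ∪ ⁅ e ⁆)) E₂ simple
      (extension-join isM coatom modX mod₁ e∈E e∉X mod₂ E₁≢X union round cover)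
      -- Iterated restrictions are definitionally equal, so `d₁` serves as a derivation for the
      -- coatom `E₁` of the extended side, and the recursion is structural.
      (coatom-extension (restrict-simple simple (cl⊆E isM (E₁ ∪ ⁅ e ⁆)))
        (extension-coatom isM coatom modX mod₁ e∈E e∉X)
        (extension-modular-coatom isM coatom modX mod₁ e∈E e∉X) d₁)
      d₂
  where isM = IsSimple.matroid simple
... | inj₂ cover = ssj-join M (cl M (E₂ ∪ ⁅ e ⁆)) E₁ simple
      (extension-join isM coatom modX mod₂ e∈E e∉X mod₁ E₂≢X (trans (∪-comm E₂ E₁) union)
        (subst (λ Z → IsRound (M ∣ Z)) (∩-comm E₁ E₂) round) cover)
      (coatom-extension (restrict-simple simple (cl⊆E isM (E₂ ∪ ⁅ e ⁆)))
        (extension-coatom isM coatom modX mod₂ e∈E e∉X)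
        (extension-modular-coatom isM coatom modX mod₂ e∈E e∉X) d₂)
      d₁
  where isM = IsSimple.matroid simple

empty-supersolvable : {M : Pre n} → IsMatroid M → E M ≡ ∅ → IsSupersolvable M
empty-supersolvable {M = M} isM E≡∅ = subst (Chain M) (sym (trans (cong (r M) E≡∅) (r∅≡0 isM)))
  ((λ _ → E M) , E≡∅ , refl , (λ _ → E-modular isM) , λ ())

ME⇒SSJ : {M : Pre n} → ME M → SSJ M
ME⇒SSJ (me-empty M simple E≡∅) =
  ssj-ss M simple (empty-supersolvable (IsSimple.matroid simple) E≡∅)
ME⇒SSJ (me-coatom M X simple coatom modX d) = coatom-extension simple coatom modX (ME⇒SSJ d)
ME⇒SSJ (me-join M E₁ E₂ simple join d₁ d₂)  = ssj-join M E₁ E₂ simple join (ME⇒SSJ d₁) (ME⇒SSJ d₂)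

-- From round joins of supersolvable matroids to `ME`.

-- The last flat before `E M` in the chain is a modular coatom, and the earlier ones form a chain of
-- its restriction. The chain length must equal the rank for the last step to drop the rank by
-- exactly one.
chain⇒ME : {M : Pre n} → IsSimple M → r M (E M) ≡ k → Chain M k → ME M
chain⇒ME {k = zero} {M = M} simple _ (Xs , first , last , _) =
  me-empty M simple (trans (sym last) first)
chain⇒ME {k = suc k} {M = M} simple rE≡ (Xs , first , last , mods , steps) =
  me-coatom M X simple (flatX , trans (cong suc rX≡k) (sym rE≡)) modX
    (chain⇒ME (restrict-simple simple X⊆E) rX≡k
      ( Xs ∘ inject₁
      , first
      , refl
      , (λ i → restrict-modular isM X⊆E (steps-⊆-last (Xs ∘ inject₁) (proj₁ ∘ steps ∘ inject₁) i) flatX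
                 (mods (inject₁ i)))
      , steps ∘ inject₁ ))
  where
  isM = IsSimple.matroid simple
  X = Xs (inject₁ (fromℕ k))
  modX : IsModularFlat M X
  modX = mods (inject₁ (fromℕ k))
  flatX : IsFlat M X
  flatX = proj₁ modX
  X⊆E : X ⊆ E M
  X⊆E = proj₁ flatX
  rank-steps : ∀ i → r M (Xs (inject₁ i)) < r M (Xs (suc i))
  rank-steps i =
    flat-<-rank isM (proj₁ (mods (inject₁ i))) (proj₁ (proj₁ (mods (suc i)))) (steps i)
  rX≡k : r M X ≡ k
  -- Above: the rank still grows in the last step to `suc k`. Below: `k` strict steps lead up to
  -- `X`.
  rX≡k = ≤-antisym
    (≤-pred (≤-trans (rank-steps (fromℕ k)) (≤-reflexive (trans (cong (r M) last) rE≡))))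
    (≤-trans (m≤m+n k _) (steps-<-last (r M ∘ Xs ∘ inject₁) (rank-steps ∘ inject₁)))

SSJ⇒ME : {M : Pre n} → SSJ M → ME M
SSJ⇒ME (ssj-ss M simple supersolvable)      = chain⇒ME simple refl supersolvable
SSJ⇒ME (ssj-join M E₁ E₂ simple join d₁ d₂) = me-join M E₁ E₂ simple join (SSJ⇒ME d₁) (SSJ⇒ME d₂)

theorem1p9 : ∀ {n : ℕ} (M : Pre n) → (ME M → SSJ M) × (SSJ M → ME M)
theorem1p9 M = ME⇒SSJ , SSJ⇒ME
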